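{- Let $p$ and $q$ be positive integers with $p<q$, and let $\varepsilon>0$. Then for all sufficiently large $n$ there is a $(q,p)$-coloring $\varphi$ of $K_n$ such that for every monochromatic subgraph $G$ of $K_n$ (with respect to $\varphi$) there is no vertex subset $U\subseteq V(G)$ with $|U|\ge \varepsilon n$ such that among any $q$ vertices of $U$ there are $p+1$ vertices having at least $\varepsilon n$ common neighbors in $G$.
   Context: A $(q,p)$-coloring of the complete graph $K_n$ is an assignment $\varphi$ to each edge $e$ of $K_n$ of a set $\varphi(e)$ of exactly $p$ colors from a fixed palette of $q$ colors. A subgraph $H$ of $K_n$ is monochromatic (with respect to $\varphi$) if $\bigcap_{e\in E(H)}\varphi(e)\neq\varnothing$. -}

module Defs where

open import Data.Nat using (ℕ; suc; _≤_; _*_)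
open import Data.Bool using (Bool; true; false; not; _∨_)
open import Data.Fin using (Fin)
open import Data.Fin.Subset using (Subset; _∈_; _∉_; _⊆_; ∣_∣)
open import Data.List using (allFin)
open import Data.Bool.ListAction using (all)
open import Data.Vec using (lookup; tabulate)
open import Data.Product using (Σ; ∃; ∃-syntax; _×_)
open import Relation.Binary.PropositionalEquality using (_≡_; _≢_)
open import Relation.Nullary using (¬_)

-- A (q,p)-coloring of K_n on vertex set Fin n: every edge {u,v} (u ≢ v)
-- gets a set of exactly p colors from the palette Fin q.  Edges are
-- unordered, encoded by a symmetric function on ordered pairs; the
-- diagonal values are irrelevant (loops are not edges).
record Coloring (q p n : ℕ) : Set where
  field
    col     : Fin n → Fin n → Subset q
    col-sym : ∀ u v → col u v ≡ col v u
    col-card : ∀ u v → u ≢ v → ∣ col u v ∣ ≡ p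
open Coloring public

record Subgraph (n : ℕ) : Set where
  field
    verts     : Subset n
    adj       : Fin n → Subset n
    adj-sym   : ∀ u v → v ∈ adj u → u ∈ adj v
    adj-loop  : ∀ u → u ∉ adj u
    adj-verts : ∀ u v → v ∈ adj u → u ∈ verts
open Subgraph public

-- G is monochromatic w.r.t. φ: the colour sets of all edges of G have a
-- common colour (for G without edges this holds trivially when q ≥ 1).
Monochromatic : ∀ {q p n} → Coloring q p n → Subgraph n → Set
Monochromatic {q} φ G = ∃[ c ] (∀ u v → v ∈ adj G u → c ∈ col φ u v)

commonNbrs : ∀ {n} → Subgraph n → Subset n → Subset n
commonNbrs {n} G T =
  tabulate λ w → all (λ v → not (lookup T v) ∨ lookup (adj G v) w) (allFin n)

-- U (with |U| ≥ εn, ε = a/b) is a "bad" set for G: U ⊆ V(G) and among any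
-- q vertices of U there are p+1 with at least εn common neighbours in G.
BadSet : (q p a b n : ℕ) → Subgraph n → Subset n → Set
BadSet q p a b n G U =
  U ⊆ verts G × a * n ≤ b * ∣ U ∣ ×
  (∀ (S : Subset n) → S ⊆ U → ∣ S ∣ ≡ q →
     ∃[ T ] (T ⊆ S × ∣ T ∣ ≡ suc p × a * n ≤ b * ∣ commonNbrs G T ∣))

{-# OPTIONS --safe #-}

-- Let m be large in terms of q and b.  A vertex u carries s(u) = u mod m and a word x(u) of length
-- m over ℤ/q, and the edge uw receives the colours c with (c + x(u)_l + x(w)_l) mod q < p, where
-- l = (u + w) mod m.  If U is dense, some s has a dense set of words among the vertices of U with
-- s(u) = s.  By isoperimetry in the Hamming space (ℤ/q)^m there is a word x such that each
-- of its q translates x + i is within distance R of a word of this set, belonging to a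
-- vertex uᵢ say.  For a vertex w let l = (s + w) mod m.  Unless l is one of the at most qR
-- exceptional positions, x(uᵢ)_l = x_l + i for all i, so every colour appears on exactly p of
-- the edges u₀w, …, u_{q-1}w.  Hence the common neighbours of any p + 1 of the uᵢ sit over exceptional
-- positions, and these are only a small proportion of all vertices.
module Submission where

open import Defs
open import Data.Bool using (Bool; true; false; not; _∨_)
open import Data.Bool.ListAction using (all)
open import Data.Fin using (Fin; zero; suc; toℕ)
open import Data.Fin.Properties using (any?)
open import Data.Fin.Subset using (Subset; _∈_; _∉_; _⊆_; ∣_∣; ⁅_⁆; _∪_) renaming (⊥ to ∅)
open import Data.Fin.Subset.Properties
  using (_∈?_; ∪-identityˡ; x∈p∪q⁺; x∈p∪q⁻; x∈⁅x⁆; x∈⁅y⁆⇒x≡y; p⊆q⇒∣p∣≤∣q∣; ∉⊥; ∣⊥∣≡0)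
open import Data.List using (List) renaming (_∷_ to _∷ˡ_)
open import Data.List.Membership.Propositional using () renaming (_∈_ to _∈ˡ_)
open import Data.List.Membership.Propositional.Properties using (∈-allFin)
open import Data.List.Relation.Unary.Any using (here; there)
open import Data.Nat
open import Data.Nat.DivMod
open import Data.Nat.Divisibility using (n∣m*n)
open import Data.Nat.Properties
open import Data.Nat.Tactic.RingSolver using (solve-∀)
open import Data.Product using (∃; ∃-syntax; Σ; _×_; _,_; proj₁; proj₂)
open import Data.Sum using (inj₁; inj₂)
open import Data.Vec using (Vec; []; _∷_; map; lookup; tabulate) renaming (here to hereᵛ; there to thereᵛ)
open import Data.Vec.Properties using (≡-dec; lookup∘tabulate; lookup⇒[]=; []=⇒lookup)
open import Function using (_∘_)
open import Relation.Binary.PropositionalEquality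
  using (_≡_; _≢_; refl; sym; trans; cong; cong₂; subst; module ≡-Reasoning)
open import Relation.Nullary using (¬_; Dec; yes; no; does; contradiction)
open import Relation.Nullary.Decidable using (dec-true; dec-false; _×-dec_)

-- Finite sums over initial segments of ℕ.

∑ : ℕ → (ℕ → ℕ) → ℕ
∑ zero    f = 0
∑ (suc n) f = f 0 + ∑ n (f ∘ suc)

∑-mono : ∀ n {f g : ℕ → ℕ} → (∀ i → i < n → f i ≤ g i) → ∑ n f ≤ ∑ n g
∑-mono zero    h = z≤n
∑-mono (suc n) h = +-mono-≤ (h 0 z<s) (∑-mono n λ i i<n → h (suc i) (s<s i<n))

∑-cong : ∀ n {f g : ℕ → ℕ} → (∀ i → i < n → f i ≡ g i) → ∑ n f ≡ ∑ n g
∑-cong zero    h = refl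
∑-cong (suc n) h = cong₂ _+_ (h 0 z<s) (∑-cong n λ i i<n → h (suc i) (s<s i<n))

∑-const : ∀ n c → ∑ n (λ _ → c) ≡ n * c
∑-const zero    c = refl
∑-const (suc n) c = cong (c +_) (∑-const n c)

∑-distrib-+ : ∀ n (f g : ℕ → ℕ) → ∑ n (λ i → f i + g i) ≡ ∑ n f + ∑ n g
∑-distrib-+ zero    f g = refl
∑-distrib-+ (suc n) f g
  rewrite ∑-distrib-+ n (f ∘ suc) (g ∘ suc) = interchange (f 0) (g 0) _ _
  where
  interchange : ∀ a b c d → (a + b) + (c + d) ≡ (a + c) + (b + d)
  interchange = solve-∀

*-distribˡ-∑ : ∀ n c (f : ℕ → ℕ) → ∑ n (λ i → c * f i) ≡ c * ∑ n f
*-distribˡ-∑ zero    c f = sym (*-zeroʳ c)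
*-distribˡ-∑ (suc n) c f
  rewrite *-distribˡ-∑ n c (f ∘ suc) = sym (*-distribˡ-+ c (f 0) _)

∑-swap : ∀ n m (f : ℕ → ℕ → ℕ) → ∑ n (λ i → ∑ m (f i)) ≡ ∑ m (λ j → ∑ n (λ i → f i j))
∑-swap zero    m f = sym (trans (∑-const m 0) (*-zeroʳ m))
∑-swap (suc n) m f
  rewrite ∑-swap n m (f ∘ suc) = sym (∑-distrib-+ m (f 0) _)

∑-snoc : ∀ n (f : ℕ → ℕ) → ∑ (suc n) f ≡ ∑ n f + f n
∑-snoc zero    f = +-comm (f 0) 0
∑-snoc (suc n) f rewrite ∑-snoc n (f ∘ suc) = sym (+-assoc (f 0) _ _)

∑-++ : ∀ m n (f : ℕ → ℕ) → ∑ (m + n) f ≡ ∑ m f + ∑ n (λ i → f (m + i))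
∑-++ zero    n f = refl
∑-++ (suc m) n f rewrite ∑-++ m n (f ∘ suc) = sym (+-assoc (f 0) _ _)

∑-monoˡ : ∀ {m n} (f : ℕ → ℕ) → m ≤ n → ∑ m f ≤ ∑ n f
∑-monoˡ f z≤n       = z≤n
∑-monoˡ f (s≤s m≤n) = +-monoʳ-≤ (f 0) (∑-monoˡ (f ∘ suc) m≤n)

term≤∑ : ∀ n (f : ℕ → ℕ) i → i < n → f i ≤ ∑ n f
term≤∑ (suc n) f zero    _         = m≤m+n _ _
term≤∑ (suc n) f (suc i) (s≤s i<n) = ≤-trans (term≤∑ n (f ∘ suc) i i<n) (m≤n+m _ _)

-- The averaging principle behind both existence arguments: an error-free position, and a word none
-- of whose translates is far.
∑-<⇒∃< : ∀ n (f g : ℕ → ℕ) → ∑ n f < ∑ n g → ∃[ i ] (i < n × f i < g i)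
∑-<⇒∃< (suc n) f g lt with f 0 <? g 0
... | yes f0<g0 = 0 , z<s , f0<g0
... | no  f0≮g0 with ∑-<⇒∃< n (f ∘ suc) (g ∘ suc)
                       (+-cancelˡ-< (g 0) _ _ (≤-<-trans (+-monoˡ-≤ _ (≮⇒≥ f0≮g0)) lt))
...   | i , i<n , fi<gi = suc i , s<s i<n , fi<gi

∑-argmax : ∀ n (f : ℕ → ℕ) → ∃[ i ] (i < suc n × (∀ j → j < suc n → f j ≤ f i))
∑-argmax zero    f = 0 , z<s , λ { zero _ → ≤-refl ; (suc j) (s≤s ()) }
∑-argmax (suc n) f with ∑-argmax n (f ∘ suc)
... | i , i<n , max with ≤-total (f 0) (f (suc i))
...   | inj₁ f0≤ = suc i , s<s i<n , λ { zero _ → f0≤ ; (suc j) (s≤s j<n) → max j j<n }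
...   | inj₂ ≤f0 = 0 , z<s , λ { zero _ → ≤-refl ; (suc j) (s≤s j<n) → ≤-trans (max j j<n) ≤f0 }

-- Sums of periodic functions and reindexing modulo a period.

module _ (q : ℕ) (f : ℕ → ℕ) (periodic : ∀ i → f (q + i) ≡ f i) where

  -- Moving the window one place drops `f r` and gains `f (r + q)`, which agree by periodicity.
  ∑-shift : ∀ r → ∑ q (λ i → f (r + i)) ≡ ∑ q f
  ∑-shift zero    = refl
  ∑-shift (suc r) = +-cancelˡ-≡ (f (r + 0)) _ _ (begin
    f (r + 0) + ∑ q (λ i → f (suc r + i))
      ≡⟨ cong (f (r + 0) +_) (∑-cong q λ i _ → cong f (sym (+-suc r i))) ⟩
    ∑ (suc q) (λ i → f (r + i))
      ≡⟨ ∑-snoc q _ ⟩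
    ∑ q (λ i → f (r + i)) + f (r + q)
      ≡⟨ cong₂ _+_ (∑-shift r) (trans (cong f (+-comm r q)) (trans (periodic r) (cong f (sym (+-identityʳ r))))) ⟩
    ∑ q f + f (r + 0)
      ≡⟨ +-comm _ (f (r + 0)) ⟩
    f (r + 0) + ∑ q f ∎)
    where open ≡-Reasoning

  ∑-periodic : ∀ k → ∑ (k * q) f ≡ k * ∑ q f
  ∑-periodic zero    = refl
  ∑-periodic (suc k) = trans (∑-++ q (k * q) f)
    (cong (∑ q f +_) (trans (∑-cong (k * q) (λ i _ → periodic i)) (∑-periodic k)))

  -- `n` is rounded up to a whole number of periods, of total length at most `n + q`. The factor `q`
  -- on the left avoids dividing by the period.
  ∑-periodic-≤ : .{{_ : NonZero q}} → ∀ n → ∑ n f * q ≤ (n + q) * ∑ q f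
  ∑-periodic-≤ n = begin
    ∑ n f * q                     ≤⟨ *-monoˡ-≤ q (∑-monoˡ f n≤) ⟩
    ∑ (suc (n / q) * q) f * q     ≡⟨ cong (_* q) (∑-periodic (suc (n / q))) ⟩
    suc (n / q) * ∑ q f * q       ≡⟨ rearrange (n / q) (∑ q f) q ⟩
    (q + n / q * q) * ∑ q f       ≤⟨ *-monoˡ-≤ (∑ q f) (+-monoʳ-≤ q (m/n*n≤m n q)) ⟩
    (q + n) * ∑ q f               ≡⟨ cong (_* ∑ q f) (+-comm q n) ⟩
    (n + q) * ∑ q f               ∎
    where
    open ≤-Reasoning
    rearrange : ∀ a s q → suc a * s * q ≡ (q + a * q) * s
    rearrange = solve-∀
    n≤ : n ≤ suc (n / q) * q
    n≤ = begin
      n                     ≡⟨ m≡m%n+[m/n]*n n q ⟩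
      n % q + n / q * q     ≤⟨ +-monoˡ-≤ _ (m%n≤n n q) ⟩
      suc (n / q) * q       ∎

-- Translation by `z` permutes the residues modulo `q`.
∑-% : ∀ q .{{_ : NonZero q}} z (f : ℕ → ℕ) → ∑ q (λ i → f ((z + i) % q)) ≡ ∑ q f
∑-% q z f = trans
  (∑-shift q (λ i → f (i % q)) (λ i → cong f (trans (cong (_% q) (+-comm q i)) ([m+n]%n≡m%n i q))) z)
  (∑-cong q λ i i<q → cong f (m<n⇒m%n≡m i<q))

-- Mixed radix: indices are split as `j + i * m` with `j < m`. This serves both the base-`q` digits
-- and the splitting of a vertex into residue and word.
∑-* : ∀ k m (f : ℕ → ℕ) → ∑ (k * m) f ≡ ∑ k (λ i → ∑ m (λ j → f (j + i * m)))
∑-* zero    m f = refl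
∑-* (suc k) m f = trans (∑-++ m (k * m) f) (cong₂ _+_
  (∑-cong m λ j _ → cong f (sym (+-identityʳ j)))
  (trans (∑-* k m (λ i → f (m + i))) (∑-cong k λ i _ → ∑-cong m λ j _ → cong f (rearrange m j (i * m)))))
  where
  rearrange : ∀ m j x → m + (j + x) ≡ j + (m + x)
  rearrange = solve-∀

-- Hamming distance.

mismatch : ℕ → ℕ → ℕ
mismatch a b with a ≟ b
... | yes _ = 0
... | no  _ = 1

mismatch-refl : ∀ a → mismatch a a ≡ 0
mismatch-refl a with a ≟ a
... | yes _   = refl
... | no  a≢a = contradiction refl a≢a

mismatch≤1 : ∀ a b → mismatch a b ≤ 1
mismatch≤1 a b with a ≟ b
... | yes _ = z≤n
... | no  _ = ≤-refl

mismatch≡0⇒≡ : ∀ a b → mismatch a b ≡ 0 → a ≡ b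
mismatch≡0⇒≡ a b eq with a ≟ b
... | yes a≡b = a≡b

dist : ∀ {m} → Vec ℕ m → Vec ℕ m → ℕ
dist []       []       = 0
dist (a ∷ x) (b ∷ y) = mismatch a b + dist x y

-- Inequalities for the isoperimetric induction.

square-bound : ∀ x y → 4 * (x * y) ≤ (x + y) * (x + y)
square-bound x y with ≤-total x y
... | inj₁ x≤y with m≤n⇒∃[o]m+o≡n x≤y
-- With the larger number written as `x + d`, the two sides differ by exactly `d * d`.
...   | d , refl = ≤-trans (m≤m+n _ (d * d)) (≤-reflexive (expand x d))
  where
  expand : ∀ x d → 4 * (x * (x + d)) + d * d ≡ (x + (x + d)) * (x + (x + d))
  expand = solve-∀
square-bound x y | inj₂ y≤x with m≤n⇒∃[o]m+o≡n y≤x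
...   | d , refl = ≤-trans (m≤m+n _ (d * d)) (≤-reflexive (expand y d))
  where
  expand : ∀ x d → 4 * ((x + d) * x) + d * d ≡ (x + d + x) * (x + d + x)
  expand = solve-∀

-- Each product (M - u i)(N - v i) is nonnegative; expand, sum over `i`, and move the negative terms
-- across.
∑-chebyshev : ∀ q (u v : ℕ → ℕ) M N → (∀ i → i < q → u i ≤ M) → (∀ i → i < q → v i ≤ N) →
  M * ∑ q v + N * ∑ q u ≤ q * (M * N) + ∑ q (λ i → u i * v i)
∑-chebyshev q u v M N u≤M v≤N = begin
  M * ∑ q v + N * ∑ q u
    ≡⟨ cong₂ _+_ (*-distribˡ-∑ q M v) (*-distribˡ-∑ q N u) ⟨
  ∑ q (λ i → M * v i) + ∑ q (λ i → N * u i)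
    ≡⟨ ∑-distrib-+ q _ _ ⟨
  ∑ q (λ i → M * v i + N * u i)
    ≤⟨ ∑-mono q (λ i i<q → pointwise (u≤M i i<q) (v≤N i i<q)) ⟩
  ∑ q (λ i → M * N + u i * v i)
    ≡⟨ ∑-distrib-+ q _ _ ⟩
  ∑ q (λ _ → M * N) + ∑ q (λ i → u i * v i)
    ≡⟨ cong (_+ _) (∑-const q (M * N)) ⟩
  q * (M * N) + ∑ q (λ i → u i * v i) ∎
  where
  open ≤-Reasoning
  pointwise : ∀ {a b A B} → a ≤ A → b ≤ B → A * b + B * a ≤ A * B + a * b
  pointwise {a} {b} a≤A b≤B with m≤n⇒∃[o]m+o≡n a≤A | m≤n⇒∃[o]m+o≡n b≤B
  ... | x , refl | y , refl = ≤-trans (m≤m+n _ (x * y)) (≤-reflexive (expand a b x y))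
    where
    expand : ∀ a b x y → (a + x) * b + (b + y) * a + x * y ≡ (a + x) * (b + y) + a * b
    expand = solve-∀

-- The difference of the two sides factors as (Y(k+1) − z)((k+1)z − k²Y).
quadratic-bound : ∀ k Y z → Y * k ≤ z → z ≤ Y * suc k →
  (z + Y * k) * (z + Y * k) * suc k ≤ (suc (k + k) * suc (k + k)) * (Y * z)
quadratic-bound k Y z lo hi with m≤n⇒∃[o]m+o≡n lo
... | w , refl with +-cancelˡ-≤ (Y * k) w Y (≤-trans hi (≤-reflexive (trans (*-suc Y k) (+-comm Y (Y * k)))))
...   | w≤Y with m≤n⇒∃[o]m+o≡n w≤Y
...     | t , refl = ≤-trans (m≤m+n _ (t * ((w + t) * k + suc k * w))) (≤-reflexive (expand k w t))
  where
  expand : ∀ k w t →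
    ((w + t) * k + w + (w + t) * k) * ((w + t) * k + w + (w + t) * k) * suc k + t * ((w + t) * k + suc k * w)
      ≡ (suc (k + k) * suc (k + k)) * ((w + t) * ((w + t) * k + w))
  expand = solve-∀

4k[1+k]+1≡[2k+1]² : ∀ k → suc (4 * (k * suc k)) ≡ suc (k + k) * suc (k + k)
4k[1+k]+1≡[2k+1]² = solve-∀

-- With P = AB and z = MN, rescaled by X(k+1), the first two hypotheses and AM-GM give
-- 4zP ≤ q²(z + Yk)².  The resulting bound on P increases with z on [Yk, Y(k+1)].
isoperimetric-step : ∀ q k A B M N Z X Y →
  M * B + N * A ≤ q * (M * N) + Z → Z * (X * suc k) ≤ q * (Y * k) → M * N * X ≤ Y → A ≤ q * M → B ≤ q * N →
  A * B * (X * suc k) * (4 * (k * suc k)) ≤ q * q * (Y * k) * (suc (k + k) * suc (k + k))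
isoperimetric-step q k A B M N Z X Y cheb Z≤ MN≤ A≤ B≤ = bound
  where
  open ≤-Reasoning
  z = M * N * X * suc k
  P = A * B * (X * suc k)
  E = suc (k + k) * suc (k + k)
  c≤E : 4 * (k * suc k) ≤ E
  c≤E = ≤-trans (n≤1+n _) (≤-reflexive (4k[1+k]+1≡[2k+1]² k))
  P≤ : P ≤ q * q * z
  P≤ = ≤-trans (*-monoˡ-≤ (X * suc k) (*-mono-≤ A≤ B≤)) (≤-reflexive (eq q M N X (suc k)))
    where
    eq : ∀ q M N X k → q * M * (q * N) * (X * k) ≡ q * q * (M * N * X * k)
    eq = solve-∀
  lin : (M * B + N * A) * (X * suc k) ≤ q * (z + Y * k)
  lin = begin
    (M * B + N * A) * (X * suc k)          ≤⟨ *-monoˡ-≤ _ cheb ⟩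
    (q * (M * N) + Z) * (X * suc k)        ≡⟨ eq q (M * N) Z X (suc k) ⟩
    q * z + Z * (X * suc k)                ≤⟨ +-monoʳ-≤ (q * z) Z≤ ⟩
    q * z + q * (Y * k)                    ≡⟨ *-distribˡ-+ q z _ ⟨
    q * (z + Y * k)                        ∎
    where
    eq : ∀ q MN Z X k → (q * MN + Z) * (X * k) ≡ q * (MN * X * k) + Z * (X * k)
    eq = solve-∀
  amgm : 4 * (z * P) ≤ q * (z + Y * k) * (q * (z + Y * k))
  amgm = begin
    4 * (z * P)
      ≡⟨ eq M N A B X (suc k) ⟩
    4 * (M * B * (X * suc k) * (N * A * (X * suc k)))
      ≤⟨ square-bound (M * B * (X * suc k)) (N * A * (X * suc k)) ⟩
    (M * B * (X * suc k) + N * A * (X * suc k)) * (M * B * (X * suc k) + N * A * (X * suc k))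
      ≡⟨ cong (λ t → t * t) (*-distribʳ-+ (X * suc k) (M * B) (N * A)) ⟨
    (M * B + N * A) * (X * suc k) * ((M * B + N * A) * (X * suc k))
      ≤⟨ *-mono-≤ lin lin ⟩
    q * (z + Y * k) * (q * (z + Y * k)) ∎
    where
    eq : ∀ M N A B X k → 4 * (M * N * X * k * (A * B * (X * k))) ≡ 4 * (M * B * (X * k) * (N * A * (X * k)))
    eq = solve-∀
  z≤ : z ≤ Y * suc k
  z≤ = *-monoˡ-≤ (suc k) MN≤

  -- Below the range where the bound is monotone in `z`, the crude estimate `P ≤ q * q * z` from
  -- `A ≤ q * M` and `B ≤ q * N` suffices.
  small : z ≤ Y * k → P * (4 * (k * suc k)) ≤ q * q * (Y * k) * E
  small z≤Yk = *-mono-≤ (≤-trans P≤ (*-monoʳ-≤ (q * q) z≤Yk)) c≤E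

  big : Y * k ≤ z → .{{NonZero z}} → P * (4 * (k * suc k)) ≤ q * q * (Y * k) * E
  big Yk≤z = *-cancelˡ-≤ z (begin
    z * (P * (4 * (k * suc k)))
      ≡⟨ eq₁ z P k (suc k) ⟩
    k * (4 * (z * P) * suc k)
      ≤⟨ *-monoʳ-≤ k (*-monoˡ-≤ (suc k) amgm) ⟩
    k * (q * (z + Y * k) * (q * (z + Y * k)) * suc k)
      ≡⟨ eq₂ k q (z + Y * k) (suc k) ⟩
    k * (q * q) * ((z + Y * k) * (z + Y * k) * suc k)
      ≤⟨ *-monoʳ-≤ (k * (q * q)) (quadratic-bound k Y z Yk≤z z≤) ⟩
    k * (q * q) * (E * (Y * z))
      ≡⟨ eq₃ k q E Y z ⟩
    z * (q * q * (Y * k) * E) ∎)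
    where
    eq₁ : ∀ z P k k' → z * (P * (4 * (k * k'))) ≡ k * (4 * (z * P) * k')
    eq₁ = solve-∀
    eq₂ : ∀ k q x k' → k * (q * x * (q * x) * k') ≡ k * (q * q) * (x * x * k')
    eq₂ = solve-∀
    eq₃ : ∀ k q E Y z → k * (q * q) * (E * (Y * z)) ≡ z * (q * q * (Y * k) * E)
    eq₃ = solve-∀

  bound : P * (4 * (k * suc k)) ≤ q * q * (Y * k) * E
  bound with z ≤? Y * k
  ... | yes z≤Yk = small z≤Yk
  ... | no  z≰Yk = big (<⇒≤ (≰⇒> z≰Yk)) {{>-nonZero (≤-<-trans z≤n (≰⇒> z≰Yk))}}

-- Words over ℤ/q and isoperimetry in the Hamming space.

module Words (q : ℕ) .{{_ : NonZero q}} where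

  -- Letters are plain naturals, and only the range of summation confines them to the alphabet. Sets
  -- of words are represented by functions with values at most 1.
  total : ∀ m → (Vec ℕ m → ℕ) → ℕ
  total zero    f = f []
  total (suc m) f = ∑ q λ a → total m λ x → f (a ∷ x)

  total-≤1 : ∀ m (f : Vec ℕ m → ℕ) → (∀ x → f x ≤ 1) → total m f ≤ q ^ m
  total-≤1 zero    f f≤1 = f≤1 []
  total-≤1 (suc m) f f≤1 = ≤-trans
    (∑-mono q λ a _ → total-≤1 m _ λ x → f≤1 (a ∷ x)) (≤-reflexive (∑-const q (q ^ m)))

  total-1 : ∀ m → total m (λ _ → 1) ≡ q ^ m
  total-1 zero    = refl
  total-1 (suc m) = trans (∑-cong q λ _ _ → total-1 m) (∑-const q (q ^ m))

  total-∑ : ∀ m n (f : ℕ → Vec ℕ m → ℕ) → total m (λ x → ∑ n λ i → f i x) ≡ ∑ n (λ i → total m (f i))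
  total-∑ zero    n f = refl
  total-∑ (suc m) n f = trans (∑-cong q λ a _ → total-∑ m n λ i x → f i (a ∷ x)) (∑-swap q n _)

  total-<⇒∃< : ∀ m (f g : Vec ℕ m → ℕ) → total m f < total m g → ∃[ x ] f x < g x
  total-<⇒∃< zero    f g lt = [] , lt
  total-<⇒∃< (suc m) f g lt with ∑-<⇒∃< q _ _ lt
  ... | a , _ , lt′ with total-<⇒∃< m _ _ lt′
  ...   | x , fx<gx = a ∷ x , fx<gx

  shift : ∀ {m} → ℕ → Vec ℕ m → Vec ℕ m
  shift i = map λ a → (i + a) % q

  total-shift : ∀ m i (f : Vec ℕ m → ℕ) → total m (f ∘ shift i) ≡ total m f
  total-shift zero    i f = refl
  total-shift (suc m) i f = begin
    ∑ q (λ a → total m λ x → f ((i + a) % q ∷ shift i x))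
      ≡⟨ ∑-cong q (λ a _ → total-shift m i λ x → f ((i + a) % q ∷ x)) ⟩
    ∑ q (λ a → fibre ((i + a) % q))
      ≡⟨ ∑-% q i fibre ⟩
    ∑ q fibre ∎
    where
    open ≡-Reasoning
    fibre : ℕ → ℕ
    fibre a = total m λ x → f (a ∷ x)

  digits : ∀ m → ℕ → Vec ℕ m
  digits zero    j = []
  digits (suc m) j = j % q ∷ digits m (j / q)

  digits-+ : ∀ m k j → digits m (j + k * q ^ m) ≡ digits m j
  digits-+ zero    k j = refl
  digits-+ (suc m) k j = cong₂ _∷_
    (trans (cong (_% q) eq) ([m+kn]%n≡m%n j (k * q ^ m) q))
    (trans (cong (digits m) quotient) (digits-+ m k (j / q)))
    where
    rearrange : ∀ j k q p → j + k * (q * p) ≡ j + k * p * q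
    rearrange = solve-∀
    eq : j + k * q ^ suc m ≡ j + k * q ^ m * q
    eq = rearrange j k q (q ^ m)
    quotient : (j + k * q ^ suc m) / q ≡ j / q + k * q ^ m
    quotient = trans (cong (_/ q) eq)
      (trans (+-distrib-/-∣ʳ j (n∣m*n (k * q ^ m))) (cong (j / q +_) (m*n/n≡m (k * q ^ m) q)))

  -- Base-`q` expansion is a bijection from the numbers below `q ^ m` to the words of length `m`;
  -- the induction splits off the lowest digit.
  ∑-digits : ∀ m (f : Vec ℕ m → ℕ) → ∑ (q ^ m) (f ∘ digits m) ≡ total m f
  ∑-digits zero    f = +-identityʳ (f [])
  ∑-digits (suc m) f = begin
    ∑ (q * q ^ m) (f ∘ digits (suc m))
      ≡⟨ cong (λ t → ∑ t (f ∘ digits (suc m))) (*-comm q (q ^ m)) ⟩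
    ∑ (q ^ m * q) (f ∘ digits (suc m))
      ≡⟨ ∑-* (q ^ m) q _ ⟩
    ∑ (q ^ m) (λ i → ∑ q λ a → f (digits (suc m) (a + i * q)))
      ≡⟨ ∑-cong (q ^ m) (λ i _ → ∑-cong q λ a a<q → cong f (digits-∷ a i a<q)) ⟩
    ∑ (q ^ m) (λ i → ∑ q λ a → f (a ∷ digits m i))
      ≡⟨ ∑-swap (q ^ m) q _ ⟩
    ∑ q (λ a → ∑ (q ^ m) λ i → f (a ∷ digits m i))
      ≡⟨ ∑-cong q (λ a _ → ∑-digits m λ x → f (a ∷ x)) ⟩
    total (suc m) f ∎
    where
    open ≡-Reasoning
    digits-∷ : ∀ a i → a < q → digits (suc m) (a + i * q) ≡ a ∷ digits m i
    digits-∷ a i a<q = cong₂ _∷_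
      (trans ([m+kn]%n≡m%n a i q) (m<n⇒m%n≡m a<q))
      (cong (digits m) (trans (+-distrib-/-∣ʳ a (n∣m*n i))
        (cong₂ _+_ (m<n⇒m/n≡0 a<q) (m*n/n≡m i q))))

  -- Induction on m: fibres of f and g over the same letter stay at distance s, while the
  -- largest fibre of f and the largest fibre of g are still at distance s − 1.
  isoperimetry : ∀ k m s (f g : Vec ℕ m → ℕ) → (∀ x → f x ≤ 1) → (∀ x → g x ≤ 1) →
    (∀ x y → 0 < f x → 0 < g y → s ≤ dist x y) →
    total m f * total m g * ((4 * (k * suc k)) ^ m * suc k ^ s)
      ≤ q ^ m * q ^ m * ((suc (k + k) * suc (k + k)) ^ m * k ^ s)
  isoperimetry k m zero f g f≤1 g≤1 far =
    *-mono-≤ (*-mono-≤ (total-≤1 m f f≤1) (total-≤1 m g g≤1)) (*-monoˡ-≤ 1 (^-monoˡ-≤ m c≤E))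
    where
    c≤E : 4 * (k * suc k) ≤ suc (k + k) * suc (k + k)
    c≤E = ≤-trans (n≤1+n _) (≤-reflexive (4k[1+k]+1≡[2k+1]² k))
  isoperimetry k zero (suc s) f g f≤1 g≤1 far with f [] in f≡ | g [] in g≡
  ... | zero  | _     = z≤n
  ... | suc a | zero  rewrite *-zeroʳ a = z≤n
  ... | suc a | suc b with () ← far [] [] (subst (0 <_) (sym f≡) z<s) (subst (0 <_) (sym g≡) z<s)
  isoperimetry k (suc m) (suc s) f g f≤1 g≤1 far = begin
    A * B * (c * c ^ m * (suc k * suc k ^ s))
      ≡⟨ eq₁ A B c (c ^ m) (suc k) (suc k ^ s) ⟩
    A * B * (X * suc k) * c
      ≤⟨ isoperimetric-step q k A B M N (∑ q λ a → u a * v a) X Y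
           (∑-chebyshev q u v M N (λ a → proj₂ (proj₂ argmax-u) a ∘ q≤) (λ a → proj₂ (proj₂ argmax-v) a ∘ q≤))
           equal-fibres max-fibres (sum≤ u M λ a → proj₂ (proj₂ argmax-u) a ∘ q≤) (sum≤ v N λ a → proj₂ (proj₂ argmax-v) a ∘ q≤) ⟩
    q * q * (Y * k) * E
      ≡⟨ eq₂ q k E (q ^ m) (E ^ m) (k ^ s) ⟩
    q * q ^ m * (q * q ^ m) * (E * E ^ m * (k * k ^ s)) ∎
    where
    open ≤-Reasoning
    c = 4 * (k * suc k)
    E = suc (k + k) * suc (k + k)
    X = c ^ m * suc k ^ s
    Y = q ^ m * q ^ m * (E ^ m * k ^ s)
    u v : ℕ → ℕ
    u a = total m λ x → f (a ∷ x)
    v a = total m λ x → g (a ∷ x)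
    A = ∑ q u
    B = ∑ q v
    q≤ : ∀ {a} → a < q → a < suc (pred q)
    q≤ {a} = subst (a <_) (sym (suc-pred q))
    argmax-u = ∑-argmax (pred q) u
    argmax-v = ∑-argmax (pred q) v
    a* = proj₁ argmax-u
    b* = proj₁ argmax-v
    M = u a*
    N = v b*
    sum≤ : ∀ (h : ℕ → ℕ) L → (∀ a → a < q → h a ≤ L) → ∑ q h ≤ q * L
    sum≤ h L h≤L = ≤-trans (∑-mono q h≤L) (≤-reflexive (∑-const q L))
    max-fibres : M * N * X ≤ Y
    max-fibres = isoperimetry k m s _ _ (λ x → f≤1 (a* ∷ x)) (λ x → g≤1 (b* ∷ x))
      λ x y fx gy → s≤s⁻¹ (≤-trans (far (a* ∷ x) (b* ∷ y) fx gy) (+-monoˡ-≤ (dist x y) (mismatch≤1 a* b*)))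
    equal-fibre : ∀ a → u a * v a * (X * suc k) ≤ Y * k
    equal-fibre a = begin
      u a * v a * (X * suc k)                       ≡⟨ eq₃ (u a * v a) (c ^ m) (suc k ^ s) (suc k) ⟩
      u a * v a * (c ^ m * suc k ^ suc s)           ≤⟨ isoperimetry k m (suc s) _ _ (λ x → f≤1 (a ∷ x)) (λ x → g≤1 (a ∷ x))
        (λ x y fx gy → subst (λ t → suc s ≤ t + dist x y) (mismatch-refl a) (far (a ∷ x) (a ∷ y) fx gy)) ⟩
      q ^ m * q ^ m * (E ^ m * (k * k ^ s))         ≡⟨ eq₄ (q ^ m * q ^ m) (E ^ m) (k ^ s) k ⟩
      Y * k                                         ∎
      where
      eq₃ : ∀ w x y z → w * (x * y * z) ≡ w * (x * (z * y))
      eq₃ = solve-∀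
      eq₄ : ∀ w x y z → w * (x * (z * y)) ≡ w * (x * y) * z
      eq₄ = solve-∀
    equal-fibres : ∑ q (λ a → u a * v a) * (X * suc k) ≤ q * (Y * k)
    equal-fibres = begin
      ∑ q (λ a → u a * v a) * (X * suc k)    ≡⟨ *-comm _ (X * suc k) ⟩
      X * suc k * ∑ q (λ a → u a * v a)      ≡⟨ *-distribˡ-∑ q (X * suc k) _ ⟨
      ∑ q (λ a → X * suc k * (u a * v a))    ≤⟨ sum≤ _ (Y * k) (λ a _ → ≤-trans (≤-reflexive (*-comm (X * suc k) _)) (equal-fibre a)) ⟩
      q * (Y * k)                            ∎
    eq₁ : ∀ A B c c' k k' → A * B * (c * c' * (k * k')) ≡ A * B * (c' * k' * k) * c
    eq₁ = solve-∀
    eq₂ : ∀ q k E p e l → q * q * (p * p * (e * l) * k) * E ≡ q * p * (q * p) * (E * e * (k * l))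
    eq₂ = solve-∀

-- Numerical estimates for the isoperimetric bound.

-- Bernoulli's inequality (1 - 1/(c+1))^j ≥ 1 - j/(c+1), cleared of denominators; the right side is
-- d/(c+1).
power-bound : ∀ j {d c} → j + d ≡ suc c → suc c ^ j * d ≤ c ^ j * suc c
power-bound zero    refl = ≤-refl
power-bound (suc j) {d} {c} eq = begin
  suc c * suc c ^ j * d       ≡⟨ eq₁ (suc c) (suc c ^ j) d ⟩
  suc c ^ j * (suc c * d)     ≤⟨ *-monoʳ-≤ (suc c ^ j) d≤ ⟩
  suc c ^ j * (suc d * c)     ≡⟨ *-assoc (suc c ^ j) (suc d) c ⟨
  suc c ^ j * suc d * c       ≤⟨ *-monoˡ-≤ c (power-bound j (trans (+-suc j d) eq)) ⟩
  c ^ j * suc c * c           ≡⟨ eq₂ (c ^ j) (suc c) c ⟩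
  c * c ^ j * suc c           ∎
  where
  open ≤-Reasoning
  eq₁ : ∀ x y z → x * y * z ≡ y * (x * z)
  eq₁ = solve-∀
  eq₂ : ∀ x y z → x * y * z ≡ z * x * y
  eq₂ = solve-∀
  d≤ : suc c * d ≤ suc d * c
  d≤ = subst (d + c * d ≤_) (cong (c +_) (*-comm c d)) (+-monoˡ-≤ (c * d)
    (≤-trans (m≤n+m d j) (≤-reflexive (suc-injective eq))))

-- In quotients this says (1 + 1/(4h(h+1)))^h < 1 + 1/h: what the isoperimetric bound loses over `h`
-- coordinates is less than what one unit of distance gains.
base-gap : ∀ h → .{{NonZero h}} →
  (suc (h + h) * suc (h + h)) ^ h * h < (4 * (h * suc h)) ^ h * suc h
base-gap h = *-cancelʳ-< (suc d) _ _ (begin-strict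
  E ^ h * h * suc d            ≡⟨ eq₁ (E ^ h) h (suc d) ⟩
  h * (E ^ h * suc d)          ≤⟨ *-monoʳ-≤ h bound′ ⟩
  h * (c ^ h * E)              ≡⟨ eq₂ h (c ^ h) E ⟩
  c ^ h * (h * E)              <⟨ *-monoʳ-< (c ^ h) {{m^n≢0 c h {{m*n≢0 4 (h * suc h) {{_}} {{m*n≢0 h (suc h)}}}}}} hE< ⟩
  c ^ h * (suc h * suc d)      ≡⟨ *-assoc (c ^ h) (suc h) (suc d) ⟨
  c ^ h * suc h * suc d        ∎)
  where
  open ≤-Reasoning
  E = suc (h + h) * suc (h + h)
  c = 4 * (h * suc h)
  -- Chosen so that `suc d` equals c + 1 - h, as `power-bound` requires for the exponent `h`.
  d = 4 * (h * h) + 3 * h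
  eq₁ : ∀ x y z → x * y * z ≡ y * (x * z)
  eq₁ = solve-∀
  eq₂ : ∀ x y z → x * (y * z) ≡ y * (x * z)
  eq₂ = solve-∀
  h+d≡ : ∀ h → h + suc (4 * (h * h) + 3 * h) ≡ suc (4 * (h * suc h))
  h+d≡ = solve-∀
  bound′ : E ^ h * suc d ≤ c ^ h * E
  bound′ = subst (λ e → e ^ h * suc d ≤ c ^ h * e) (4k[1+k]+1≡[2k+1]² h) (power-bound h (h+d≡ h))
  hE≡ : ∀ h → suc (h * (suc (h + h) * suc (h + h))) + (3 * (h * h) + 3 * h) ≡ suc h * suc (4 * (h * h) + 3 * h)
  hE≡ = solve-∀
  hE< : h * E < suc h * suc d
  hE< = ≤-trans (m≤m+n _ (3 * (h * h) + 3 * h)) (≤-reflexive (hE≡ h))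

-- For positive `n` this is (1 + 1/n)^r ≥ 1 + r/n, multiplied by n^(r+1).
bernoulli : ∀ n r → (n + r) * n ^ r ≤ n * suc n ^ r
bernoulli n zero    = ≤-reflexive (cong (_* 1) (+-identityʳ n))
bernoulli n (suc r) = begin
  (n + suc r) * (n * n ^ r)       ≡⟨ *-assoc (n + suc r) n (n ^ r) ⟨
  (n + suc r) * n * n ^ r         ≤⟨ *-monoˡ-≤ (n ^ r) (≤-trans (m≤m+n _ r) (≤-reflexive (eq n r))) ⟩
  suc n * (n + r) * n ^ r         ≡⟨ *-assoc (suc n) (n + r) (n ^ r) ⟩
  suc n * ((n + r) * n ^ r)       ≤⟨ *-monoʳ-≤ (suc n) (bernoulli n r) ⟩
  suc n * (n * suc n ^ r)         ≡⟨ eq₂ (suc n) n (suc n ^ r) ⟩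
  n * (suc n * suc n ^ r)         ∎
  where
  open ≤-Reasoning
  eq : ∀ n r → (n + suc r) * n + r ≡ suc n * (n + r)
  eq = solve-∀
  eq₂ : ∀ x y z → x * (y * z) ≡ y * (x * z)
  eq₂ = solve-∀

-- D/N is at least 1 + 1/N, so by Bernoulli its power with exponent `C * N` reaches 1 + C.
exponential-gap : ∀ C N D → .{{NonZero N}} → N < D → suc C * N ^ (C * N) ≤ D ^ (C * N)
exponential-gap C N D N<D = ≤-trans
  (*-cancelˡ-≤ N (≤-trans (≤-reflexive (eq N C (N ^ (C * N)))) (bernoulli N (C * N))))
  (^-monoˡ-≤ (C * N) N<D)
  where
  eq : ∀ N C x → N * (suc C * x) ≡ (N + C * N) * x
  eq = solve-∀

-- Counting in subsets of `Fin n`.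

⟦_⟧ : Bool → ℕ
⟦ true ⟧  = 1
⟦ false ⟧ = 0

⟦⟧≤1 : ∀ b → ⟦ b ⟧ ≤ 1
⟦⟧≤1 true  = ≤-refl
⟦⟧≤1 false = z≤n

∑-<? : ∀ {p q} → p ≤ q → ∑ q (λ i → ⟦ does (i <? p) ⟧) ≡ p
∑-<? {p} p≤q with m≤n⇒∃[o]m+o≡n p≤q
... | o , refl = begin
  ∑ (p + o) (λ i → ⟦ does (i <? p) ⟧)
    ≡⟨ ∑-++ p o _ ⟩
  ∑ p (λ i → ⟦ does (i <? p) ⟧) + ∑ o (λ i → ⟦ does (p + i <? p) ⟧)
    ≡⟨ cong₂ _+_ (∑-cong p λ i i<p → cong ⟦_⟧ (dec-true (i <? p) i<p))
                 (∑-cong o λ i _ → cong ⟦_⟧ (dec-false (p + i <? p) (m+n≮m p i))) ⟩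
  ∑ p (λ _ → 1) + ∑ o (λ _ → 0)
    ≡⟨ cong₂ _+_ (trans (∑-const p 1) (*-identityʳ p)) (trans (∑-const o 0) (*-zeroʳ o)) ⟩
  p + 0
    ≡⟨ +-identityʳ p ⟩
  p ∎
  where open ≡-Reasoning

-- Subsets are cut out by tests on naturals, so that their sizes become sums to which the
-- periodicity lemmas apply.
below : ∀ n → (ℕ → Bool) → Subset n
below n h = tabulate (h ∘ toℕ)

∣below∣ : ∀ n h → ∣ below n h ∣ ≡ ∑ n (⟦_⟧ ∘ h)
∣below∣ zero    h = refl
∣below∣ (suc n) h with h 0
... | true  = cong suc (∣below∣ n (h ∘ suc))
... | false = ∣below∣ n (h ∘ suc)

∈-below⁺ : ∀ {n} h (i : Fin n) → h (toℕ i) ≡ true → i ∈ below n h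
∈-below⁺ h i hi = lookup⇒[]= i _ (trans (lookup∘tabulate (h ∘ toℕ) i) hi)

∈-below⁻ : ∀ {n} h (i : Fin n) → i ∈ below n h → h (toℕ i) ≡ true
∈-below⁻ h i i∈ = trans (sym (lookup∘tabulate (h ∘ toℕ) i)) ([]=⇒lookup i∈)

∣⁅x⁆∪p∣≤ : ∀ {n} (x : Fin n) p → ∣ ⁅ x ⁆ ∪ p ∣ ≤ suc ∣ p ∣
∣⁅x⁆∪p∣≤ zero    (true  ∷ p) rewrite ∪-identityˡ p = n≤1+n _
∣⁅x⁆∪p∣≤ zero    (false ∷ p) rewrite ∪-identityˡ p = ≤-refl
∣⁅x⁆∪p∣≤ (suc x) (true  ∷ p) = s≤s (∣⁅x⁆∪p∣≤ x p)
∣⁅x⁆∪p∣≤ (suc x) (false ∷ p) = ∣⁅x⁆∪p∣≤ x p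

x∉p⇒∣⁅x⁆∪p∣ : ∀ {n} (x : Fin n) p → x ∉ p → ∣ ⁅ x ⁆ ∪ p ∣ ≡ suc ∣ p ∣
x∉p⇒∣⁅x⁆∪p∣ zero    (true  ∷ p) x∉p = contradiction hereᵛ x∉p
x∉p⇒∣⁅x⁆∪p∣ zero    (false ∷ p) x∉p rewrite ∪-identityˡ p = refl
x∉p⇒∣⁅x⁆∪p∣ (suc x) (true  ∷ p) x∉p = cong suc (x∉p⇒∣⁅x⁆∪p∣ x p (x∉p ∘ thereᵛ))
x∉p⇒∣⁅x⁆∪p∣ (suc x) (false ∷ p) x∉p = x∉p⇒∣⁅x⁆∪p∣ x p (x∉p ∘ thereᵛ)

image : ∀ {n} → ℕ → (ℕ → Bool) → (ℕ → Fin n) → Subset n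
image zero    h u = ∅
image (suc k) h u with h 0
... | true  = ⁅ u 0 ⁆ ∪ image k (h ∘ suc) (u ∘ suc)
... | false = image k (h ∘ suc) (u ∘ suc)

∈-image⁺ : ∀ {n} k h (u : ℕ → Fin n) i → i < k → h i ≡ true → u i ∈ image k h u
∈-image⁺ (suc k) h u i i<k hi with h 0 in h0
∈-image⁺ (suc k) h u zero    i<k       hi | true  = x∈p∪q⁺ (inj₁ (x∈⁅x⁆ (u 0)))
∈-image⁺ (suc k) h u (suc i) (s≤s i<k) hi | true  = x∈p∪q⁺ (inj₂ (∈-image⁺ k (h ∘ suc) (u ∘ suc) i i<k hi))
∈-image⁺ (suc k) h u zero    i<k       hi | false with () ← trans (sym h0) hi
∈-image⁺ (suc k) h u (suc i) (s≤s i<k) hi | false = ∈-image⁺ k (h ∘ suc) (u ∘ suc) i i<k hi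

∈-image⁻ : ∀ {n} k h (u : ℕ → Fin n) {t} → t ∈ image k h u → ∃[ i ] (i < k × t ≡ u i)
∈-image⁻ zero    h u t∈ = contradiction t∈ ∉⊥
∈-image⁻ (suc k) h u t∈ with h 0
∈-image⁻ (suc k) h u t∈ | false with ∈-image⁻ k (h ∘ suc) (u ∘ suc) t∈
... | i , i<k , t≡ = suc i , s<s i<k , t≡
∈-image⁻ (suc k) h u t∈ | true with x∈p∪q⁻ ⁅ u 0 ⁆ _ t∈
... | inj₁ t∈u0 = 0 , z<s , x∈⁅y⁆⇒x≡y (u 0) t∈u0
... | inj₂ t∈′ with ∈-image⁻ k (h ∘ suc) (u ∘ suc) t∈′
...   | i , i<k , t≡ = suc i , s<s i<k , t≡

-- Coinciding values of `u` can only shrink the image.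
∣image∣≤ : ∀ {n} k h (u : ℕ → Fin n) → ∣ image k h u ∣ ≤ ∑ k (⟦_⟧ ∘ h)
∣image∣≤ {n} zero h u = ≤-reflexive (∣⊥∣≡0 n)
∣image∣≤ (suc k) h u with h 0
... | true  = ≤-trans (∣⁅x⁆∪p∣≤ (u 0) _) (s≤s (∣image∣≤ k (h ∘ suc) (u ∘ suc)))
... | false = ∣image∣≤ k (h ∘ suc) (u ∘ suc)

∣image∣-injective : ∀ {n} k (u : ℕ → Fin n) → (∀ i j → i < k → j < k → u i ≡ u j → i ≡ j) →
  ∣ image k (λ _ → true) u ∣ ≡ k
∣image∣-injective {n} zero u inj = ∣⊥∣≡0 n
∣image∣-injective (suc k) u inj = trans
  (x∉p⇒∣⁅x⁆∪p∣ (u 0) _ u0∉)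
  (cong suc (∣image∣-injective k (u ∘ suc)
    λ i j i<k j<k eq → suc-injective (inj (suc i) (suc j) (s<s i<k) (s<s j<k) eq)))
  where
  u0∉ : u 0 ∉ image k (λ _ → true) (u ∘ suc)
  u0∉ u0∈ with ∈-image⁻ k _ (u ∘ suc) u0∈
  ... | i , i<k , eq with () ← inj 0 (suc i) z<s (s<s i<k) eq

all⁻ : ∀ {A : Set} (f : A → Bool) {xs : List A} → all f xs ≡ true → ∀ {x} → x ∈ˡ xs → f x ≡ true
all⁻ f {y ∷ˡ xs} eq x∈ with f y in fy
all⁻ f {y ∷ˡ xs} eq (here refl) | true = fy
all⁻ f {y ∷ˡ xs} eq (there x∈)  | true = all⁻ f eq x∈

∈-commonNbrs⁻ : ∀ {n} (G : Subgraph n) T {w} → w ∈ commonNbrs G T → ∀ {t} → t ∈ T → w ∈ adj G t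
∈-commonNbrs⁻ {n} G T {w} w∈ {t} t∈T = lookup⇒[]= w _
  (subst (λ b → not b ∨ lookup (adj G t) w ≡ true) ([]=⇒lookup t∈T)
    (all⁻ (λ v → not (lookup T v) ∨ lookup (adj G v) w)
      (trans (sym (lookup∘tabulate _ w)) ([]=⇒lookup w∈)) (∈-allFin t)))

-- Letters of words and residue arithmetic.

nth : ∀ {m} → Vec ℕ m → ℕ → ℕ
nth []      l       = 0
nth (a ∷ x) zero    = a
nth (a ∷ x) (suc l) = nth x l

∑-mismatch : ∀ {m} (x y : Vec ℕ m) → ∑ m (λ l → mismatch (nth x l) (nth y l)) ≡ dist x y
∑-mismatch []      []      = refl
∑-mismatch (a ∷ x) (b ∷ y) = cong (mismatch a b +_) (∑-mismatch x y)

nth-map : ∀ {m} (f : ℕ → ℕ) (x : Vec ℕ m) {l} → l < m → nth (map f x) l ≡ f (nth x l)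
nth-map f (a ∷ x) {zero}  _         = refl
nth-map f (a ∷ x) {suc l} (s≤s l<m) = nth-map f x l<m

[m+n%d]%d≡[m+n]%d : ∀ m n d .{{_ : NonZero d}} → (m + n % d) % d ≡ (m + n) % d
[m+n%d]%d≡[m+n]%d m n d = begin
  (m + n % d) % d             ≡⟨ %-distribˡ-+ m (n % d) d ⟩
  (m % d + n % d % d) % d     ≡⟨ cong (λ t → (m % d + t) % d) (m%n%n≡m%n n d) ⟩
  (m % d + n % d) % d         ≡⟨ %-distribˡ-+ m n d ⟨
  (m + n) % d                 ∎
  where open ≡-Reasoning

-- Adding `d ∸ x % d`, a representative of -x modulo `d`, recovers each of `i` and `j`.
%-+-cancelʳ : ∀ {i j} x d .{{_ : NonZero d}} → i < d → j < d → (i + x) % d ≡ (j + x) % d → i ≡ j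
%-+-cancelʳ {i} {j} x d i<d j<d eq = begin
  i                               ≡⟨ recover i i<d ⟨
  ((d ∸ x % d) + (i + x) % d) % d ≡⟨ cong (λ t → ((d ∸ x % d) + t) % d) eq ⟩
  ((d ∸ x % d) + (j + x) % d) % d ≡⟨ recover j j<d ⟩
  j                               ∎
  where
  open ≡-Reasoning
  rearrange : ∀ y i r → y + (i + r) ≡ i + (y + r)
  rearrange = solve-∀
  recover : ∀ i → i < d → ((d ∸ x % d) + (i + x) % d) % d ≡ i
  recover i i<d = begin
    ((d ∸ x % d) + (i + x) % d) % d     ≡⟨ cong (λ t → ((d ∸ x % d) + t) % d) ([m+n%d]%d≡[m+n]%d i x d) ⟨
    ((d ∸ x % d) + (i + x % d) % d) % d ≡⟨ [m+n%d]%d≡[m+n]%d (d ∸ x % d) (i + x % d) d ⟩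
    ((d ∸ x % d) + (i + x % d)) % d     ≡⟨ cong (_% d) (rearrange (d ∸ x % d) i (x % d)) ⟩
    (i + ((d ∸ x % d) + x % d)) % d     ≡⟨ cong (λ t → (i + t) % d) (m∸n+n≡m (m%n≤n x d)) ⟩
    (i + d) % d                         ≡⟨ [m+n]%n≡m%n i d ⟩
    i % d                               ≡⟨ m<n⇒m%n≡m i<d ⟩
    i                                   ∎

^-distribʳ-* : ∀ x y n → (x * y) ^ n ≡ x ^ n * y ^ n
^-distribʳ-* x y zero    = refl
^-distribʳ-* x y (suc n) rewrite ^-distribʳ-* x y n = interchange x y (x ^ n) (y ^ n)
  where
  interchange : ∀ a b c d → a * b * (c * d) ≡ a * c * (b * d)
  interchange = solve-∀

-- The coloring.

module Construction (p q m : ℕ) .{{_ : NonZero q}} .{{_ : NonZero m}} where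

  open Words q

  -- Taking the digits of `u / m` makes the word independent of the residue `u % m`: any `q ^ m * m`
  -- consecutive vertices realise each pair of residue and word exactly once.
  word : ℕ → Vec ℕ m
  word u = digits m (u / m)

  hue : ℕ → ℕ → ℕ
  hue u w = nth (word u) ((u + w) % m) + nth (word w) ((u + w) % m)

  hue-comm : ∀ u w → hue u w ≡ hue w u
  hue-comm u w = trans
    (cong (λ t → nth (word u) (t % m) + nth (word w) (t % m)) (+-comm u w))
    (+-comm (nth (word u) ((w + u) % m)) (nth (word w) ((w + u) % m)))

  hasColour : ℕ → ℕ → Bool
  hasColour z c = does ((z + c) % q <? p)

  -- As the index runs over ℤ/q, so does its translate by `z`. This is used twice: with colours as
  -- indices it gives the size of a colour set, and with the indices of the vertices uᵢ it counts
  -- the edges to `w` of one colour.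
  ∑-hasColour : p ≤ q → ∀ z → ∑ q (⟦_⟧ ∘ hasColour z) ≡ p
  ∑-hasColour p≤q z = trans (∑-% q z (λ i → ⟦ does (i <? p) ⟧)) (∑-<? p≤q)

  coloring : p ≤ q → ∀ n → Coloring q p n
  coloring p≤q n .col u w = below q (hasColour (hue (toℕ u) (toℕ w)))
  coloring p≤q n .col-sym u w = cong (below q ∘ hasColour) (hue-comm (toℕ u) (toℕ w))
  coloring p≤q n .col-card u w _ =
    trans (∣below∣ q (hasColour (hue (toℕ u) (toℕ w)))) (∑-hasColour p≤q (hue (toℕ u) (toℕ w)))

  -- A vertex set in a monochromatic subgraph.

  module _ {n} (p≤q : p ≤ q) (G : Subgraph n) (mono : Monochromatic (coloring p≤q n) G) (U : Subset n) where

    Near : ℕ → ℕ → Vec ℕ m → Set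
    Near R s x = ∃[ u ] (u ∈ U × toℕ u % m ≡ s × dist (word (toℕ u)) x < R)

    near? : ∀ R s x → Dec (Near R s x)
    near? R s x = any? λ u → u ∈? U ×-dec toℕ u % m ≟ s ×-dec dist (word (toℕ u)) x <? R

    Hit : ℕ → Vec ℕ m → Set
    Hit s x = ∃[ u ] (u ∈ U × toℕ u % m ≡ s × word (toℕ u) ≡ x)

    hit? : ∀ s x → Dec (Hit s x)
    hit? s x = any? λ u → u ∈? U ×-dec toℕ u % m ≟ s ×-dec ≡-dec _≟_ (word (toℕ u)) x

    hit : ℕ → Vec ℕ m → ℕ
    hit s x = ⟦ does (hit? s x) ⟧

    -- Together with `hit`, the pair of word sets to which isoperimetry is applied: the words
    -- occurring in `U` over residue `s`, and those at distance at least `R` from all of them.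
    far : ℕ → ℕ → Vec ℕ m → ℕ
    far R s x = ⟦ not (does (near? R s x)) ⟧

    hit-far : ∀ R s x y → 0 < hit s x → 0 < far R s y → R ≤ dist x y
    hit-far R s x y hx fy with hit? s x | near? R s y
    ... | yes (u , u∈U , u≡s , refl) | no ¬near = ≮⇒≥ λ d<R → ¬near (u , u∈U , u≡s , d<R)

    -- Vertices of `U` near all translates of one word.

    module Cluster (a b R s : ℕ) (x : Vec ℕ m) (near : ∀ i → i < q → Near R s (shift i x))
             (qR<m : q * R < m) (m≤n : m ≤ n) (m-large : b * (2 * (q * R)) < a * m) (0<n : 0 < n) where

      -- Reducing the index modulo `q` makes the choice of vertices a total function on ℕ, as
      -- `image` and `∑` expect.
      near′ : ∀ i → Near R s (shift (i % q) x)
      near′ i = near (i % q) (m%n<n i q)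

      u : ℕ → Fin n
      u i = proj₁ (near′ i)

      error : ℕ → ℕ
      error l = ∑ q λ i → mismatch (nth (word (toℕ (u i))) l) (nth (shift (i % q) x) l)

      -- Double counting: summed by vertex rather than by position, the errors form `q` distances,
      -- each below `R`.
      ∑-error : ∑ m error ≤ q * R
      ∑-error = begin
        ∑ m error
          ≡⟨ ∑-swap m q _ ⟩
        ∑ q (λ i → ∑ m λ l → mismatch (nth (word (toℕ (u i))) l) (nth (shift (i % q) x) l))
          ≡⟨ ∑-cong q (λ i _ → ∑-mismatch (word (toℕ (u i))) (shift (i % q) x)) ⟩
        ∑ q (λ i → dist (word (toℕ (u i))) (shift (i % q) x))
          ≤⟨ ∑-mono q (λ i _ → <⇒≤ (proj₂ (proj₂ (proj₂ (near′ i))))) ⟩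
        ∑ q (λ _ → R)
          ≡⟨ ∑-const q R ⟩
        q * R ∎
        where open ≤-Reasoning

      error≡0⇒ : ∀ {l} → l < m → error l ≡ 0 → ∀ i → i < q →
        nth (word (toℕ (u i))) l ≡ (i + nth x l) % q
      error≡0⇒ {l} l<m e≡0 i i<q = begin
        nth (word (toℕ (u i))) l     ≡⟨ mismatch≡0⇒≡ _ _ (n≤0⇒n≡0 (≤-trans (term≤∑ q _ i i<q) (≤-reflexive e≡0))) ⟩
        nth (shift (i % q) x) l      ≡⟨ nth-map _ x l<m ⟩
        (i % q + nth x l) % q        ≡⟨ cong (λ t → (t + nth x l) % q) (m<n⇒m%n≡m i<q) ⟩
        (i + nth x l) % q            ∎
        where open ≡-Reasoning

      -- There are fewer than `m` errors, so some position has none. There the letters of `u i` and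
      -- `u j` are the letter of `x` translated by `i` and by `j`, so equal vertices force equal
      -- indices.
      u-injective : ∀ i j → i < q → j < q → u i ≡ u j → i ≡ j
      u-injective i j i<q j<q eq with ∑-<⇒∃< m error (λ _ → 1)
        (subst (∑ m error <_) (sym (trans (∑-const m 1) (*-identityʳ m))) (≤-<-trans ∑-error qR<m))
      ... | l , l<m , e<1 = %-+-cancelʳ (nth x l) q i<q j<q (trans (sym (error≡0⇒ l<m e≡0 i i<q))
        (trans (cong (λ t → nth (word (toℕ t)) l) eq) (error≡0⇒ l<m e≡0 j j<q)))
        where e≡0 = n<1⇒n≡0 e<1

      S : Subset n
      S = image q (λ _ → true) u

      S⊆U : S ⊆ U
      S⊆U t∈S with ∈-image⁻ q _ u t∈S
      ... | i , _ , refl = proj₁ (proj₂ (near′ i))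

      ∣S∣≡q : ∣ S ∣ ≡ q
      ∣S∣≡q = ∣image∣-injective q u u-injective

      module _ (T : Subset n) (T⊆S : T ⊆ S) (∣T∣≡1+p : ∣ T ∣ ≡ suc p) where

        c = proj₁ mono

        -- All `u i` have residue `s`, so their edges to `w` read the same position. Were it
        -- error-free, only `p` indices would give an edge with the common colour `c`, too few for
        -- the `suc p` elements of `T`.
        error≢0 : ∀ w → w ∈ commonNbrs G T → error ((s + toℕ w) % m) ≢ 0
        error≢0 w w∈ e≡0 = <-irrefl refl (begin-strict
          p                                    <⟨ ≤-reflexive (sym ∣T∣≡1+p) ⟩
          ∣ T ∣                                ≤⟨ p⊆q⇒∣p∣≤∣q∣ T⊆image ⟩
          ∣ image q (hasColour z) u ∣          ≤⟨ ∣image∣≤ q (hasColour z) u ⟩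
          ∑ q (⟦_⟧ ∘ hasColour z)              ≡⟨ ∑-hasColour p≤q z ⟩
          p                                    ∎)
          where
          open ≤-Reasoning
          l = (s + toℕ w) % m
          d = nth (word (toℕ w)) l
          -- The part of hue plus colour that does not vary with `i`; the edge from `u i`
          -- contributes the residue of `z + i`.
          z = nth x l + d + toℕ c
          index : ∀ i → (toℕ (u i) + toℕ w) % m ≡ l
          index i = trans (cong (_% m) (+-comm (toℕ (u i)) (toℕ w)))
            (trans (sym ([m+n%d]%d≡[m+n]%d (toℕ w) (toℕ (u i)) m))
              (trans (cong (λ t → (toℕ w + t) % m) (proj₁ (proj₂ (proj₂ (near′ i)))))
                (cong (_% m) (+-comm (toℕ w) s))))
          rearrange₁ : ∀ y d c → y + d + c ≡ d + c + y
          rearrange₁ = solve-∀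
          rearrange₂ : ∀ d c i x → d + c + (i + x) ≡ x + d + c + i
          rearrange₂ = solve-∀
          residue : ∀ i → i < q → (hue (toℕ (u i)) (toℕ w) + toℕ c) % q ≡ (z + i) % q
          residue i i<q rewrite index i | error≡0⇒ (m%n<n (s + toℕ w) m) e≡0 i i<q =
            trans (cong (_% q) (rearrange₁ ((i + nth x l) % q) d (toℕ c)))
              (trans ([m+n%d]%d≡[m+n]%d (d + toℕ c) (i + nth x l) q)
                (cong (_% q) (rearrange₂ d (toℕ c) i (nth x l))))
          T⊆image : T ⊆ image q (hasColour z) u
          T⊆image t∈T with ∈-image⁻ q _ u (T⊆S t∈T)
          ... | i , i<q , refl = ∈-image⁺ q (hasColour z) u i i<q
            (trans (cong (λ r → does (r <? p)) (sym (residue i i<q)))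
              (∈-below⁻ (hasColour (hue (toℕ (u i)) (toℕ w))) c (proj₂ mono (u i) w (∈-commonNbrs⁻ G T w∈ t∈T))))

        -- Every common neighbour `w` contributes at least 1 to the sum of the errors at
        -- `(s + w) % m`. That sum covers at most `(n + m) / m` periods' worth of errors, and
        -- `m ≤ n`.
        commonNbrs-small : ∣ commonNbrs G T ∣ * m ≤ n * (2 * (q * R))
        commonNbrs-small = begin
          ∣ commonNbrs G T ∣ * m
            ≤⟨ *-monoˡ-≤ m (p⊆q⇒∣p∣≤∣q∣ ⊆bad) ⟩
          ∣ below n bad ∣ * m
            ≡⟨ cong (_* m) (∣below∣ n bad) ⟩
          ∑ n (⟦_⟧ ∘ bad) * m
            ≤⟨ *-monoˡ-≤ m (∑-mono n λ w _ → bad≤ w) ⟩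
          ∑ n (λ w → error ((s + w) % m)) * m
            ≤⟨ ∑-periodic-≤ m _ periodic n ⟩
          (n + m) * ∑ m (λ w → error ((s + w) % m))
            ≡⟨ cong ((n + m) *_) (∑-% m s error) ⟩
          (n + m) * ∑ m error
            ≤⟨ *-mono-≤ (+-monoʳ-≤ n m≤n) ∑-error ⟩
          (n + n) * (q * R)
            ≡⟨ double n (q * R) ⟩
          n * (2 * (q * R)) ∎
          where
          open ≤-Reasoning
          double : ∀ n x → (n + n) * x ≡ n * (2 * x)
          double = solve-∀
          bad : ℕ → Bool
          bad w = does (0 <? error ((s + w) % m))
          bad≤ : ∀ w → ⟦ bad w ⟧ ≤ error ((s + w) % m)
          bad≤ w with error ((s + w) % m)
          ... | zero  = z≤n
          ... | suc _ = s≤s z≤n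
          periodic : ∀ w → error ((s + (m + w)) % m) ≡ error ((s + w) % m)
          periodic w = cong error (trans (cong (_% m) (rearrange s m w)) ([m+n]%n≡m%n (s + w) m))
            where
            rearrange : ∀ s m w → s + (m + w) ≡ s + w + m
            rearrange = solve-∀
          ⊆bad : commonNbrs G T ⊆ below n bad
          ⊆bad {w} w∈ = ∈-below⁺ bad w (dec-true (0 <? _) (n≢0⇒n>0 (error≢0 w w∈)))

      ¬rich : ¬ (∀ (S : Subset n) → S ⊆ U → ∣ S ∣ ≡ q →
        ∃[ T ] (T ⊆ S × ∣ T ∣ ≡ suc p × a * n ≤ b * ∣ commonNbrs G T ∣))
      ¬rich rich with rich S S⊆U ∣S∣≡q
      ... | T , T⊆S , ∣T∣≡ , large = <-irrefl refl (begin-strict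
        n * (b * (2 * (q * R)))              <⟨ *-monoʳ-< n {{>-nonZero 0<n}} m-large ⟩
        n * (a * m)                          ≡⟨ eq₁ n a m ⟩
        a * n * m                            ≤⟨ *-monoˡ-≤ m large ⟩
        b * ∣ commonNbrs G T ∣ * m           ≡⟨ *-assoc b _ m ⟩
        b * (∣ commonNbrs G T ∣ * m)         ≤⟨ *-monoʳ-≤ b (commonNbrs-small T T⊆S ∣T∣≡) ⟩
        b * (n * (2 * (q * R)))              ≡⟨ eq₂ b n (2 * (q * R)) ⟩
        n * (b * (2 * (q * R)))              ∎)
        where
        open ≤-Reasoning
        eq₁ : ∀ n a m → n * (a * m) ≡ a * n * m
        eq₁ = solve-∀
        eq₂ : ∀ b n x → b * (n * x) ≡ n * (b * x)
        eq₂ = solve-∀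

    -- A union bound: each translation preserves the number of far words, so fewer than `q ^ m`
    -- words have some far translate.
    few-far⇒near : ∀ R s → q * total m (far R s) < q ^ m → ∃[ x ] (∀ i → i < q → Near R s (shift i x))
    few-far⇒near R s few with total-<⇒∃< m (λ x → ∑ q λ i → far R s (shift i x)) (λ _ → 1) (begin-strict
        total m (λ x → ∑ q λ i → far R s (shift i x))    ≡⟨ total-∑ m q _ ⟩
        ∑ q (λ i → total m (far R s ∘ shift i))          ≡⟨ ∑-cong q (λ i _ → total-shift m i (far R s)) ⟩
        ∑ q (λ _ → total m (far R s))                    ≡⟨ ∑-const q _ ⟩
        q * total m (far R s)                            <⟨ few ⟩
        q ^ m                                            ≡⟨ total-1 m ⟨
        total m (λ _ → 1)                                ∎)
      where open ≤-Reasoning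
    ... | x , <1 = x , λ i i<q → far≡0⇒ (shift i x) (n<1⇒n≡0 (≤-<-trans (term≤∑ q _ i i<q) <1))
      where
      far≡0⇒ : ∀ y → far R s y ≡ 0 → Near R s y
      far≡0⇒ y eq with near? R s y
      ... | yes near = near

    -- `U` lies in the set of vertices whose residue and word are hit. That set is periodic, and one
    -- period runs once through all pairs; the factor 2 comes from rounding `n` up to whole periods.
    ∣U∣-bound : q ^ m * m ≤ n → ∣ U ∣ * (q ^ m * m) ≤ 2 * n * ∑ m (λ s → total m (hit s))
    ∣U∣-bound K≤n = begin
      ∣ U ∣ * K
        ≤⟨ *-monoˡ-≤ K (p⊆q⇒∣p∣≤∣q∣ U⊆) ⟩
      ∣ below n inU ∣ * K
        ≡⟨ cong (_* K) (∣below∣ n inU) ⟩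
      ∑ n f * K
        ≤⟨ ∑-periodic-≤ K f periodic {{m*n≢0 (q ^ m) m {{m^n≢0 q m}}}} n ⟩
      (n + K) * ∑ K f
        ≤⟨ *-monoˡ-≤ (∑ K f) (+-monoʳ-≤ n (≤-trans K≤n (≤-reflexive (sym (+-identityʳ n))))) ⟩
      2 * n * ∑ K f
        ≡⟨ cong (2 * n *_) ∑K ⟩
      2 * n * ∑ m (λ s → total m (hit s)) ∎
      where
      open ≤-Reasoning
      K = q ^ m * m
      inU : ℕ → Bool
      inU u = does (hit? (u % m) (word u))
      f : ℕ → ℕ
      f u = hit (u % m) (word u)
      U⊆ : U ⊆ below n inU
      U⊆ {u} u∈U = ∈-below⁺ inU u (dec-true (hit? _ _) (u , u∈U , refl , refl))
      word-+ : ∀ s i → s < m → word (s + i * m) ≡ digits m i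
      word-+ s i s<m = cong (digits m) (trans (+-distrib-/-∣ʳ s (n∣m*n i))
        (cong₂ _+_ (m<n⇒m/n≡0 s<m) (m*n/n≡m i m)))
      periodic : ∀ u → f (K + u) ≡ f u
      periodic u = cong₂ hit
        (trans (cong (_% m) (+-comm K u)) ([m+kn]%n≡m%n u (q ^ m) m))
        (trans (cong (digits m) (trans (cong (_/ m) (+-comm K u))
          (trans (+-distrib-/-∣ʳ u (n∣m*n (q ^ m))) (cong (u / m +_) (trans (m*n/n≡m (q ^ m) m) (sym (+-identityʳ (q ^ m))))))))
          (digits-+ m 1 (u / m)))
      ∑K : ∑ K f ≡ ∑ m (λ s → total m (hit s))
      ∑K = begin-equality
        ∑ K f
          ≡⟨ ∑-* (q ^ m) m f ⟩
        ∑ (q ^ m) (λ i → ∑ m λ s → f (s + i * m))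
          ≡⟨ ∑-cong (q ^ m) (λ i _ → ∑-cong m λ s s<m → cong₂ hit
               (trans ([m+kn]%n≡m%n s i m) (m<n⇒m%n≡m s<m)) (word-+ s i s<m)) ⟩
        ∑ (q ^ m) (λ i → ∑ m λ s → hit s (digits m i))
          ≡⟨ ∑-swap (q ^ m) m _ ⟩
        ∑ m (λ s → ∑ (q ^ m) (hit s ∘ digits m))
          ≡⟨ ∑-cong m (λ s _ → ∑-digits m (hit s)) ⟩
        ∑ m (λ s → total m (hit s)) ∎

-- Choice of parameters.

^-regroup : ∀ x y h R → (x ^ h * y) ^ R ≡ x ^ (h * R) * y ^ R
^-regroup x y h R = trans (^-distribʳ-* (x ^ h) y R) (cong (_* y ^ R) (^-*-assoc x h R))

-- Cleared of denominators, the isoperimetric factor ((2k+1)²/(4k(k+1)))^m (k/(k+1))^R is to be at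
-- most 1/(C+1).
Gap : ℕ → ℕ → ℕ → ℕ → Set
Gap C k m R = suc C * ((suc (k + k) * suc (k + k)) ^ m * k ^ R) ≤ (4 * (k * suc k)) ^ m * suc k ^ R

-- With word length `h * R`, the two quantities being compared are `R`-th powers whose bases are
-- strictly ordered by `base-gap`; `exponential-gap` then dictates the exponent `R = C * N`.
gap-exists : ∀ C h → .{{NonZero C}} → .{{NonZero h}} → ∃[ R ] (0 < R × Gap C h (h * R) R)
gap-exists C h = R , >-nonZero⁻¹ R {{m*n≢0 C N}} , (begin
  suc C * (E ^ (h * R) * h ^ R)        ≡⟨ cong (suc C *_) (^-regroup E h h R) ⟨
  suc C * N ^ R                        ≤⟨ exponential-gap C N (c ^ h * suc h) (base-gap h) ⟩
  (c ^ h * suc h) ^ R                  ≡⟨ ^-regroup c (suc h) h R ⟩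
  c ^ (h * R) * suc h ^ R              ∎)
  where
  open ≤-Reasoning
  c = 4 * (h * suc h)
  E = suc (h + h) * suc (h + h)
  N = E ^ h * h
  R = C * N
  instance
    N≢0 : NonZero N
    N≢0 = m*n≢0 (E ^ h) h {{m^n≢0 E h}}

-- The final count.

module Existence (p q b k m R : ℕ) (p≤q : p ≤ q) .{{_ : NonZero q}} .{{_ : NonZero b}} .{{_ : NonZero k}} .{{_ : NonZero m}}
  (gap : Gap (2 * (b * q)) k m R) (CR<m : 2 * (b * q) * R < m) where

  private
    C c E G H : ℕ
    -- The 2 comes from `∣U∣-bound`, `b` from the density of `U`, and `q` from `hits-bound`. The
    -- same product appears in the bound on common neighbours, whence the hypothesis `CR<m`.
    C = 2 * (b * q)
    c = 4 * (k * suc k)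
    E = suc (k + k) * suc (k + k)
    G = c ^ m * suc k ^ R
    H = E ^ m * k ^ R

    instance
      qᵐ≢0 : NonZero (q ^ m)
      qᵐ≢0 = m^n≢0 q m
      K≢0 : NonZero (q ^ m * m)
      K≢0 = m*n≢0 (q ^ m) m

    H≢0 : NonZero H
    H≢0 = m*n≢0 (E ^ m) (k ^ R) {{m^n≢0 E m}} {{m^n≢0 k R}}

    qR<m : q * R < m
    qR<m = ≤-<-trans (*-monoˡ-≤ R (≤-trans (m≤n*m q b) (m≤n*m (b * q) 2))) CR<m

    open Words q
    open Construction p q m

  threshold : ℕ
  threshold = q ^ m * m

  good-coloring : ∀ n → Coloring q p n
  good-coloring = coloring p≤q

  -- The quantity `b * ∣ U ∣ * K * G` is bounded below through the density of `U` and `gap`, and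
  -- above through the hit words. The two bounds are `suc C` and `C` times the same positive number.
  good-coloring-¬BadSet : ∀ a n → .{{NonZero a}} → threshold ≤ n →
    ∀ (G : Subgraph n) → Monochromatic (good-coloring n) G → ¬ (∃[ U ] BadSet q p a b n G U)
  good-coloring-¬BadSet a n K≤n 𝒢 mono (U , _ , large , rich) = <-irrefl refl (begin-strict
    n * K * (C * H)                        <⟨ *-monoʳ-< (n * K) {{m*n≢0 n K {{>-nonZero 0<n}}}} (*-monoˡ-< H {{H≢0}} (n<1+n C)) ⟩
    n * K * (suc C * H)                    ≤⟨ *-monoʳ-≤ (n * K) (≤-trans gap (m≤n*m G a)) ⟩
    n * K * (a * G)                        ≡⟨ eq₁ n K a G ⟩
    a * n * K * G                          ≤⟨ *-monoˡ-≤ G (*-monoˡ-≤ K large) ⟩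
    b * ∣ U ∣ * K * G                      ≡⟨ cong (_* G) (*-assoc b ∣ U ∣ K) ⟩
    b * (∣ U ∣ * K) * G                    ≤⟨ *-monoˡ-≤ G (*-monoʳ-≤ b (∣U∣-bound p≤q 𝒢 mono U K≤n)) ⟩
    b * (2 * n * Ω) * G                    ≡⟨ eq₂ b n Ω G ⟩
    b * 2 * n * (Ω * G)                    ≤⟨ *-monoʳ-≤ (b * 2 * n) Ω-bound ⟩
    b * 2 * n * (m * (q * (q ^ m * H)))    ≡⟨ eq₃ b n m q (q ^ m) H ⟩
    n * K * (C * H)                        ∎)
    where
    open ≤-Reasoning
    K = threshold
    0<n : 0 < n
    0<n = <-≤-trans (>-nonZero⁻¹ K) K≤n
    hits : ℕ → ℕ
    hits s = total m (hit p≤q 𝒢 mono U s)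
    fars : ℕ → ℕ
    fars s = total m (far p≤q 𝒢 mono U R s)
    Ω = ∑ m hits
    eq₁ : ∀ n K a G → n * K * (a * G) ≡ a * n * K * G
    eq₁ = solve-∀
    eq₂ : ∀ b n W G → b * (2 * n * W) * G ≡ b * 2 * n * (W * G)
    eq₂ = solve-∀
    eq₃ : ∀ b n m q Q H → b * 2 * n * (m * (q * (Q * H))) ≡ n * (Q * m) * (2 * (b * q) * H)
    eq₃ = solve-∀

    -- Otherwise some word has all its translates near, and the resulting cluster refutes `rich`.
    many-far : ∀ s → q ^ m ≤ q * fars s
    many-far s with q * fars s <? q ^ m
    ... | no  ¬few = ≮⇒≥ ¬few
    ... | yes few with few-far⇒near p≤q 𝒢 mono U R s few
    ...   | x , near = contradiction rich
      (Cluster.¬rich p≤q 𝒢 mono U a b R s x near qR<m (≤-trans (m≤n*m m (q ^ m)) K≤n) m-large 0<n)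
      where
      eq : ∀ b q R → b * (2 * (q * R)) ≡ 2 * (b * q) * R
      eq = solve-∀
      m-large : b * (2 * (q * R)) < a * m
      m-large = <-≤-trans (≤-<-trans (≤-reflexive (eq b q R)) CR<m) (m≤n*m m a)

    -- Far words make up at least a 1/q share of all words, so isoperimetry leaves little room for
    -- the hit ones.
    hits-bound : ∀ s → hits s * G ≤ q * (q ^ m * H)
    hits-bound s = *-cancelˡ-≤ (q ^ m) (begin
      q ^ m * (hits s * G)               ≤⟨ *-monoˡ-≤ (hits s * G) (many-far s) ⟩
      q * fars s * (hits s * G)          ≡⟨ eq₄ q (fars s) (hits s) G ⟩
      q * (hits s * fars s * G)          ≤⟨ *-monoʳ-≤ q (isoperimetry k m R _ _ (λ _ → ⟦⟧≤1 _) (λ _ → ⟦⟧≤1 _)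
                                              (hit-far p≤q 𝒢 mono U R s)) ⟩
      q * (q ^ m * q ^ m * H)            ≡⟨ eq₅ q (q ^ m) H ⟩
      q ^ m * (q * (q ^ m * H))          ∎)
      where
      eq₄ : ∀ q f g G → q * f * (g * G) ≡ q * (g * f * G)
      eq₄ = solve-∀
      eq₅ : ∀ q Q H → q * (Q * Q * H) ≡ Q * (q * (Q * H))
      eq₅ = solve-∀

    Ω-bound : Ω * G ≤ m * (q * (q ^ m * H))
    Ω-bound = begin
      Ω * G                            ≡⟨ *-comm Ω G ⟩
      G * Ω                            ≡⟨ *-distribˡ-∑ m G hits ⟨
      ∑ m (λ s → G * hits s)           ≤⟨ ∑-mono m (λ s _ → ≤-trans (≤-reflexive (*-comm G (hits s))) (hits-bound s)) ⟩
      ∑ m (λ _ → q * (q ^ m * H))      ≡⟨ ∑-const m _ ⟩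
      m * (q * (q ^ m * H))            ∎

theorem1p4 : ∀ (p q : ℕ) → 0 < p → p < q → ∀ (a b : ℕ) → 0 < a → 0 < b →
    ∃[ N ] (∀ n → N ≤ n → Σ (Coloring q p n) λ φ →
    ∀ (G : Subgraph n) → Monochromatic φ G →
    ¬ (∃[ U ] BadSet q p a b n G U))
theorem1p4 p q _ p<q a b 0<a 0<b =
  threshold , λ n N≤n → good-coloring n , good-coloring-¬BadSet a n N≤n
  where
  instance
    q≢0 : NonZero q
    q≢0 = >-nonZero (≤-<-trans z≤n p<q)
    b≢0 : NonZero b
    b≢0 = >-nonZero 0<b
    a≢0 : NonZero a
    a≢0 = >-nonZero 0<a
  C = 2 * (b * q)
  -- Taking `h = suc C` makes the word length `suc C * R`, which exceeds `C * R` because `R` is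
  -- positive.
  gap = gap-exists C (suc C) {{m*n≢0 2 (b * q) {{_}} {{m*n≢0 b q}}}}
  R = proj₁ gap
  CR<m : C * R < suc C * R
  CR<m = *-monoˡ-< R {{>-nonZero (proj₁ (proj₂ gap))}} (n<1+n C)
  open Existence p q b (suc C) (suc C * R) R (<⇒≤ p<q) {{q≢0}} {{b≢0}} {{_}} {{>-nonZero (≤-<-trans z≤n CR<m)}}
    (proj₂ (proj₂ gap)) CR<m
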